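{- Let $n$ be a positive integer, let $A(n)=(a_{ij})_{i,j\in\mathbb{N}}$ be the greedy matrix described in the context, and let $\sigma=2n^3-n(n-3)$. Then there exist integers $pp\geq 0$ and $p\geq 1$ such that $a_{i+p,j+p}=a_{ij}$ for all $i>pp$ and all $j\ge 1$, and $pp+p\leq 2^{\sigma^2}$.
   Context: $\mathbb{N}=\{1,2,3,\dots\}$. Fix a positive integer $n$. The infinite $\{0,1\}$-matrix $A(n)=(a_{ij})_{i,j\in\mathbb{N}}$ is defined recursively. Its entries are determined row by row (row $1$ first), and within each row from left to right, so that $a_{kl}$ is determined after all $a_{ij}$ with $i<k$ and all $a_{kj}$ with $j<l$. One sets $a_{kl}=1$ if and only if all of the following hold: (1) $\sum_{j<l}a_{kj}<n+1$; (2) $\sum_{i<k}a_{il}<n+1$; (3) there is no pair $(i,j)$ with $1\le i<k$, $1\le j<l$ and $a_{ij}=a_{il}=a_{kj}=1$. Otherwise $a_{kl}=0$. -}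

module Defs where

open import Data.Bool using (Bool; true; false; _∧_; _∨_; not; if_then_else_; T)
open import Data.Bool.Properties using (T-≡; T-∧; T-∨)
open import Data.Integer as ℤ using (ℤ; +_)
open import Data.Nat using (ℕ; zero; suc; pred; _+_; _≤_; _<_; _<ᵇ_; z≤n; s≤s)
open import Data.Nat.Properties using (≤-refl; m≤n⇒m≤1+n; m≤n⇒m<n∨m≡n; <⇒<ᵇ; <ᵇ⇒<)
open import Data.Product using (_×_; _,_; ∃₂; ∃)
open import Data.Sum using (inj₁; inj₂)
open import Data.Unit using (tt)
open import Function.Bundles using (_⇔_; mk⇔; Equivalence)
open import Relation.Binary.PropositionalEquality using (_≡_; refl)
open import Relation.Nullary using (¬_)

-- Entries are Booleans, true standing for 1.
bit : Bool → ℕ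
bit b = if b then 1 else 0

-- Rows and columns are numbered from 1; the value at index 0 is never read
-- when computing an entry with positive indices (see a-greedy below).
module Greedy (n : ℕ) where

  mutual

    a : ℕ → ℕ → Bool
    a zero    _       = false
    a (suc _) zero    = false
    a (suc k) (suc l) =
        (rowSum (suc k) l <ᵇ n + 1)
      ∧ (colSum k (suc l) <ᵇ n + 1)
      ∧ not (corner (suc k) (suc l) k l)

    -- Σ_{1 ≤ j ≤ m} a k j
    rowSum : ℕ → ℕ → ℕ
    rowSum k zero    = 0
    rowSum k (suc m) = rowSum k m + bit (a k (suc m))

    -- Σ_{1 ≤ i ≤ m} a i l
    colSum : ℕ → ℕ → ℕ
    colSum zero    l = 0
    colSum (suc m) l = colSum m l + bit (a (suc m) l)

    -- Is there (i , j) with 1 ≤ i ≤ r, 1 ≤ j ≤ s and a i j = a i l = a k j = 1?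
    corner : (k l r s : ℕ) → Bool
    corner k l zero    s = false
    corner k l (suc r) s = corner k l r s ∨ cornerInRow k l (suc r) s

    -- The same with i fixed.
    cornerInRow : (k l i s : ℕ) → Bool
    cornerInRow k l i zero    = false
    cornerInRow k l i (suc s) =
      cornerInRow k l i s ∨ (a i (suc s) ∧ a i l ∧ a k (suc s))

  private

    open Equivalence using (to; from)

    T-not : ∀ b → T (not b) ⇔ (¬ T b)
    T-not true  = mk⇔ (λ ()) (λ ¬t → ¬t tt)
    T-not false = mk⇔ (λ _ ()) (λ _ → tt)

    Corner : (k l i j : ℕ) → Set
    Corner k l i j = a i j ≡ true × a i l ≡ true × a k j ≡ true

    cornerInRow-sound : ∀ k l i s → T (cornerInRow k l i s) →
      ∃ λ j → 1 ≤ j × j < suc s × Corner k l i j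
    cornerInRow-sound k l i (suc s) t with T-∨ .to t
    ... | inj₁ u = let j , 1≤j , j≤s , c = cornerInRow-sound k l i s u
                   in j , 1≤j , m≤n⇒m≤1+n j≤s , c
    ... | inj₂ u = let x , yz = T-∧ .to u ; y , z = T-∧ {a i l} .to yz
                   in suc s , s≤s z≤n , ≤-refl , T-≡ .to x , T-≡ .to y , T-≡ .to z

    cornerInRow-complete : ∀ k l i s j → 1 ≤ j → j < suc s → Corner k l i j →
      T (cornerInRow k l i s)
    cornerInRow-complete k l i zero    j (s≤s _) (s≤s ()) c
    cornerInRow-complete k l i (suc s) j 1≤j (s≤s j≤s) c with m≤n⇒m<n∨m≡n j≤s
    ... | inj₁ j<s = T-∨ .from (inj₁ (cornerInRow-complete k l i s j 1≤j j<s c))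
    ... | inj₂ refl = let x , y , z = c in
      T-∨ {cornerInRow k l i s} .from (inj₂
        (T-∧ .from (T-≡ .from x , T-∧ .from (T-≡ .from y , T-≡ .from z))))

    corner-sound : ∀ k l r s → T (corner k l r s) →
      ∃₂ λ i j → (1 ≤ i × i < suc r) × (1 ≤ j × j < suc s) × Corner k l i j
    corner-sound k l (suc r) s t with T-∨ .to t
    ... | inj₁ u = let i , j , (1≤i , i≤r) , rest = corner-sound k l r s u
                   in i , j , (1≤i , m≤n⇒m≤1+n i≤r) , rest
    ... | inj₂ u = let j , 1≤j , j≤s , c = cornerInRow-sound k l (suc r) s u
                   in suc r , j , (s≤s z≤n , ≤-refl) , (1≤j , j≤s) , c

    corner-complete : ∀ k l r s i j → 1 ≤ i → i < suc r → 1 ≤ j → j < suc s →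
      Corner k l i j → T (corner k l r s)
    corner-complete k l zero    s i j (s≤s _) (s≤s ()) _ _ c
    corner-complete k l (suc r) s i j 1≤i (s≤s i≤r) 1≤j j≤s c with m≤n⇒m<n∨m≡n i≤r
    ... | inj₁ i<r = T-∨ .from (inj₁ (corner-complete k l r s i j 1≤i i<r 1≤j j≤s c))
    ... | inj₂ refl = T-∨ {corner k l r s} .from
      (inj₂ (cornerInRow-complete k l i s j 1≤j j≤s c))

  -- The three defining conditions of the matrix.  Not used in any definition;
  -- it certifies that the Boolean recursion computes the intended entries.
  a-greedy : ∀ k l → 1 ≤ k → 1 ≤ l →
    a k l ≡ true ⇔
      ( rowSum k (pred l) < n + 1
      × colSum (pred k) l < n + 1
      × ¬ (∃₂ λ i j → (1 ≤ i × i < k) × (1 ≤ j × j < l)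
             × a i j ≡ true × a i l ≡ true × a k j ≡ true))
  a-greedy (suc k) (suc l) _ _ = mk⇔ there back
    where
    R C N : Bool
    R = rowSum (suc k) l <ᵇ n + 1
    C = colSum k (suc l) <ᵇ n + 1
    N = corner (suc k) (suc l) k l
    there : _ → _
    there e =
      let r , cn = T-∧ {R} .to (T-≡ .from e)
          c , nn = T-∧ {C} .to cn
      in <ᵇ⇒< _ _ r , <ᵇ⇒< _ _ c ,
         λ { (i , j , (1≤i , i<k) , (1≤j , j<l) , x) →
             T-not N .to nn (corner-complete (suc k) (suc l) k l i j 1≤i i<k 1≤j j<l x) }
    back : _ → _
    back (r , c , ¬x) = T-≡ .to (T-∧ {R} .from (<⇒<ᵇ r , T-∧ {C} .from (<⇒<ᵇ c ,
      T-not N .from (λ t → ¬x (corner-sound (suc k) (suc l) k l t)))))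

A : ℕ → ℕ → ℕ → Bool
A n = Greedy.a n

σ : ℕ → ℤ
σ n = + 2 ℤ.* (+ n) ℤ.^ 3 ℤ.- + n ℤ.* (+ n ℤ.- + 3)

{-# OPTIONS --safe #-}

-- Write w = n³ + n.  If a k l = 1, then each of the l − 1 earlier places of row k
-- carries a 1 (at most n places), lies in a column filled by the rows above
-- (at most k − 1 places), or completes a rectangle (at most n³ places).  Hence
-- l ≤ k + w, and since the rule is symmetric in rows and columns, the matrix is
-- symmetric and supported on the band |k − l| ≤ w.  An entry (q + x , q + y) with
-- x , y > w therefore only sees entries of the quadrant beyond (q , q), so this
-- quadrant is determined by its first w rows, that is, by a w × 2w window.
-- Two of the windows at q = 0 , … , 2^(2w²) coincide, and 2^(2w²) + w ≤ 2^(σ²).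
module Submission where

open import Defs
open import Data.Bool using (Bool; true; false; _∧_; _∨_; not; T)
open import Data.Bool.Properties using (⇔→≡)
open import Data.Fin using (Fin; toℕ; fromℕ<; combine; remQuot; funToFin; finToFun) renaming (zero to 0F; suc to sucF)
open import Data.Fin.Properties using (pigeonhole; toℕ<n; toℕ-fromℕ<; remQuot-combine; finToFun-funToFin)
open import Data.Integer as ℤ using (∣_∣; +_)
import Data.Integer.Properties as ℤ
import Data.Integer.Tactic.RingSolver as ℤ-Solver
open import Data.Nat using (ℕ; zero; suc; pred; _+_; _*_; _∸_; _^_; _≤_; _<_; _≥_; _>_; _<ᵇ_; _≤?_; z≤n; s≤s)
open import Data.Nat.Properties
import Data.Nat.Tactic.RingSolver as ℕ-Solver
open import Data.Product using (∃; ∃₂; _×_; _,_; proj₁; proj₂)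
open import Function using (_∘_)
open import Function.Bundles using (mk⇔; Equivalence)
open import Relation.Binary.PropositionalEquality using (_≡_; _≗_; refl; sym; trans; cong; cong₂; subst; subst₂)
open import Relation.Nullary using (yes; no; contradiction)

-- Sums over 1, …, m

∑ : ℕ → (ℕ → ℕ) → ℕ
∑ zero    f = 0
∑ (suc m) f = ∑ m f + f (suc m)

∑-cong : ∀ m {f g} → f ≗ g → ∑ m f ≡ ∑ m g
∑-cong zero    f≗g = refl
∑-cong (suc m) f≗g = cong₂ _+_ (∑-cong m f≗g) (f≗g (suc m))

∑-mono : ∀ m {f g} → (∀ i → i < m → f (suc i) ≤ g (suc i)) → ∑ m f ≤ ∑ m g
∑-mono zero    f≤g = z≤n
∑-mono (suc m) f≤g = +-mono-≤ (∑-mono m (λ i i<m → f≤g i (m≤n⇒m≤1+n i<m))) (f≤g m ≤-refl)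

∑-const : ∀ m c → ∑ m (λ _ → c) ≡ m * c
∑-const zero    c = refl
∑-const (suc m) c = trans (cong (_+ c) (∑-const m c)) (+-comm (m * c) c)

∑-+ : ∀ m f g → ∑ m (λ i → f i + g i) ≡ ∑ m f + ∑ m g
∑-+ zero    f g = refl
∑-+ (suc m) f g = trans (cong (_+ (f (suc m) + g (suc m))) (∑-+ m f g))
  (interchange (∑ m f) (∑ m g) (f (suc m)) (g (suc m)))
  where
  interchange : ∀ a b c d → a + b + (c + d) ≡ a + c + (b + d)
  interchange = ℕ-Solver.solve-∀

*-∑ : ∀ m c f → ∑ m (λ i → c * f i) ≡ c * ∑ m f
*-∑ zero    c f = sym (*-zeroʳ c)
*-∑ (suc m) c f = trans (cong (_+ c * f (suc m)) (*-∑ m c f)) (sym (*-distribˡ-+ c (∑ m f) (f (suc m))))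

∑-swap : ∀ l m (f : ℕ → ℕ → ℕ) → ∑ l (λ i → ∑ m (f i)) ≡ ∑ m (λ j → ∑ l (λ i → f i j))
∑-swap zero    m f = sym (trans (∑-const m 0) (*-zeroʳ m))
∑-swap (suc l) m f = trans (cong (_+ ∑ m (f (suc l))) (∑-swap l m f))
  (sym (∑-+ m (λ j → ∑ l (λ i → f i j)) (f (suc l))))

-- With the diagonal term ∑ y kept on the left, bounds the pairs j < m without
-- having to split the sums at m.
∑-strict-pairs : ∀ m (x y : ℕ → ℕ) → (∀ i → y i ≤ x i * y i) →
  ∑ m (λ i → x i * ∑ (pred i) y) + ∑ m y ≤ ∑ m x * ∑ m y
∑-strict-pairs zero    x y y≤xy = z≤n
∑-strict-pairs (suc m) x y y≤xy = begin
  D + x′ * Y + (Y + y′)             ≡⟨ regroup D (x′ * Y) Y y′ ⟩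
  (D + Y) + (x′ * Y + y′)           ≤⟨ +-mono-≤ (∑-strict-pairs m x y y≤xy) (+-monoʳ-≤ (x′ * Y) (y≤xy (suc m))) ⟩
  X * Y + (x′ * Y + x′ * y′)        ≤⟨ m≤m+n _ (X * y′) ⟩
  X * Y + (x′ * Y + x′ * y′) + X * y′ ≡⟨ expand X x′ Y y′ ⟩
  (X + x′) * (Y + y′)               ∎
  where
  open ≤-Reasoning
  X = ∑ m x
  Y = ∑ m y
  x′ = x (suc m)
  y′ = y (suc m)
  D = ∑ m (λ i → x i * ∑ (pred i) y)
  regroup : ∀ a b c d → a + b + (c + d) ≡ (a + c) + (b + d)
  regroup = ℕ-Solver.solve-∀
  expand : ∀ X x Y y → X * Y + (x * Y + x * y) + X * y ≡ (X + x) * (Y + y)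
  expand = ℕ-Solver.solve-∀

-- Indicator inequalities for Booleans.

bit-∨ : ∀ b c → bit (b ∨ c) ≤ bit b + bit c
bit-∨ true  c = s≤s z≤n
bit-∨ false c = ≤-refl

bit-∧ : ∀ b c d → bit (b ∧ c ∧ d) ≡ bit c * (bit b * bit d)
bit-∧ false false d = refl
bit-∧ false true  d = refl
bit-∧ true  false d = refl
bit-∧ true  true  d = sym (trans (+-identityʳ _) (+-identityʳ _))

bit*-absorb : ∀ b c → bit b * c ≤ bit b * (bit b * c)
bit*-absorb true  c = ≤-reflexive (sym (+-identityʳ _))
bit*-absorb false c = z≤n

-- Once the row condition `r` holds, a place without a 1 fails the column condition or completes a
-- rectangle. The sum form lets these cases be added up along a row.
bit-cases : ∀ r c d → T r → 1 ≤ bit (r ∧ c ∧ not d) + bit (not c) + bit d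
bit-cases true true  true  _ = ≤-refl
bit-cases true true  false _ = ≤-refl
bit-cases true false d     _ = s≤s z≤n

-- Markov's inequality for a single count `c` with threshold `m`; summed over columns it bounds the
-- number of full ones.
≤-*-bit-≮ᵇ : ∀ c m → m * bit (not (c <ᵇ m)) ≤ c
≤-*-bit-≮ᵇ c m with c <ᵇ m in eq
... | true  = ≤-trans (≤-reflexive (*-zeroʳ m)) z≤n
... | false = ≤-trans (≤-reflexive (*-identityʳ m))
  (≮⇒≥ (λ c<m → subst T eq (<⇒<ᵇ c<m)))

module _ (n : ℕ) where

  open Greedy n
  open Equivalence using (to; from)

  width : ℕ
  width = n * (n * n) + n

  -- Row and column counts.

  rowSum-∑ : ∀ k m → rowSum k m ≡ ∑ m (bit ∘ a k)
  rowSum-∑ k zero    = refl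
  rowSum-∑ k (suc m) = cong (_+ bit (a k (suc m))) (rowSum-∑ k m)

  colSum-∑ : ∀ m l → colSum m l ≡ ∑ m (λ i → bit (a i l))
  colSum-∑ zero    l = refl
  colSum-∑ (suc m) l = cong (_+ bit (a (suc m) l)) (colSum-∑ m l)

  rowSum-before : ∀ k l → a (suc k) (suc l) ≡ true → rowSum (suc k) l ≤ n
  rowSum-before k l e =
    ≤-pred (subst (rowSum (suc k) l <_) (+-comm n 1) (proj₁ (a-greedy (suc k) (suc l) (s≤s z≤n) (s≤s z≤n) .to e)))

  colSum-before : ∀ k l → a (suc k) (suc l) ≡ true → colSum k (suc l) ≤ n
  colSum-before k l e =
    ≤-pred (subst (colSum k (suc l) <_) (+-comm n 1) (proj₁ (proj₂ (a-greedy (suc k) (suc l) (s≤s z≤n) (s≤s z≤n) .to e))))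

  -- At a 1 the bound comes from the greedy rule, which allowed at most `n` ones before it; at a 0
  -- it is inherited.
  rowSum-≤ : ∀ k m → rowSum (suc k) m ≤ suc n
  rowSum-≤ k zero    = z≤n
  rowSum-≤ k (suc m) with a (suc k) (suc m) in e
  ... | false = subst (_≤ suc n) (sym (+-identityʳ _)) (rowSum-≤ k m)
  ... | true  = subst (_≤ suc n) (+-comm 1 _) (s≤s (rowSum-before k m e))

  rowSum-mono : ∀ k {l m} → l ≤ m → rowSum k l ≤ rowSum k m
  rowSum-mono k {l} {m} l≤m = subst (λ m → rowSum k l ≤ rowSum k m) (m∸n+n≡m l≤m) (grow (m ∸ l))
    where
    grow : ∀ d → rowSum k l ≤ rowSum k (d + l)
    grow zero    = ≤-refl
    grow (suc d) = ≤-trans (grow d) (m≤m+n _ _)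

  -- Support in a band: the bound to the right of the diagonal.

  cornerInRow-≤ : ∀ k l i s →
    bit (cornerInRow k l i s) ≤ bit (a i l) * ∑ s (λ j → bit (a i j) * bit (a k j))
  cornerInRow-≤ k l i zero    = z≤n
  cornerInRow-≤ k l i (suc s) = begin
    bit (cornerInRow k l i s ∨ (a i (suc s) ∧ a i l ∧ a k (suc s)))
      ≤⟨ bit-∨ (cornerInRow k l i s) _ ⟩
    bit (cornerInRow k l i s) + bit (a i (suc s) ∧ a i l ∧ a k (suc s))
      ≤⟨ +-mono-≤ (cornerInRow-≤ k l i s) (≤-reflexive (bit-∧ (a i (suc s)) (a i l) (a k (suc s)))) ⟩
    bit (a i l) * ∑ s _ + bit (a i l) * (bit (a i (suc s)) * bit (a k (suc s)))
      ≡⟨ *-distribˡ-+ (bit (a i l)) _ _ ⟨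
    bit (a i l) * ∑ (suc s) (λ j → bit (a i j) * bit (a k j)) ∎
    where open ≤-Reasoning

  -- Union bound: the existence of a rectangle is replaced by the number of its possible opposite
  -- corners `(i , j)`, which can be summed over `l`.
  corner-≤ : ∀ k l r s →
    bit (corner k l r s) ≤ ∑ r (λ i → bit (a i l) * ∑ s (λ j → bit (a i j) * bit (a k j)))
  corner-≤ k l zero    s = z≤n
  corner-≤ k l (suc r) s =
    ≤-trans (bit-∨ (corner k l r s) _) (+-mono-≤ (corner-≤ k l r s) (cornerInRow-≤ k l (suc r) s))

  -- Double counting of the ones in the first `k` rows: a full column holds at least `n + 1` of
  -- them, a row at most `n + 1`, and the common factor cancels.
  full-columns-≤ : ∀ k l → ∑ l (λ m → bit (not (colSum k m <ᵇ n + 1))) ≤ k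
  full-columns-≤ k l = *-cancelˡ-≤ (suc n) (begin
    suc n * ∑ l full                        ≡⟨ *-∑ l (suc n) full ⟨
    ∑ l (λ m → suc n * full m)              ≤⟨ ∑-mono l (λ m _ → full-≤ (suc m)) ⟩
    ∑ l (colSum k)                          ≡⟨ ∑-cong l (colSum-∑ k) ⟩
    ∑ l (λ m → ∑ k (λ i → bit (a i m)))     ≡⟨ ∑-swap k l (λ i m → bit (a i m)) ⟨
    ∑ k (λ i → ∑ l (bit ∘ a i))             ≡⟨ ∑-cong k (λ i → rowSum-∑ i l) ⟨
    ∑ k (λ i → rowSum i l)                  ≤⟨ ∑-mono k (λ i _ → rowSum-≤ i l) ⟩
    ∑ k (λ _ → suc n)                       ≡⟨ ∑-const k (suc n) ⟩
    k * suc n                               ≡⟨ *-comm k (suc n) ⟩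
    suc n * k                               ∎)
    where
    open ≤-Reasoning
    full : ℕ → ℕ
    full m = bit (not (colSum k m <ᵇ n + 1))
    full-≤ : ∀ m → suc n * full m ≤ colSum k m
    full-≤ m = subst (λ N → N * full m ≤ colSum k m) (+-comm n 1) (≤-*-bit-≮ᵇ (colSum k m) (n + 1))

  -- Counts triples `(j , i , m)` with `n` choices each: `j` is a 1 of row `suc k`, `i` a 1 above it
  -- in column `j`, and `m` a later 1 of row `i`. The sums are swapped so that `m` is counted first
  -- and `j` last.
  corners-≤ : ∀ k l → rowSum (suc k) l ≤ n →
    ∑ l (λ m → ∑ k (λ i → bit (a i m) * ∑ (pred m) (λ j → bit (a i j) * bit (a (suc k) j)))) ≤ n * (n * n)
  corners-≤ k l few = begin
    ∑ l (λ m → ∑ k (λ i → bit (a i m) * ∑ (pred m) (common i)))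
      ≡⟨ ∑-swap k l (λ i m → bit (a i m) * ∑ (pred m) (common i)) ⟨
    ∑ k (λ i → ∑ l (λ m → bit (a i m) * ∑ (pred m) (common i)))
      ≤⟨ ∑-mono k (λ i _ → pairs-≤ i) ⟩
    ∑ k (λ i → n * ∑ l (common i))
      ≡⟨ *-∑ k n (λ i → ∑ l (common i)) ⟩
    n * ∑ k (λ i → ∑ l (common i))
      ≡⟨ cong (n *_) (∑-swap k l common) ⟩
    n * ∑ l (λ j → ∑ k (λ i → common i j))
      ≤⟨ *-monoʳ-≤ n (∑-mono l (λ j _ → column-≤ j)) ⟩
    n * ∑ l (λ j → n * bit (a (suc k) j))
      ≡⟨ cong (n *_) (*-∑ l n (bit ∘ a (suc k))) ⟩
    n * (n * ∑ l (bit ∘ a (suc k)))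
      ≡⟨ cong (λ s → n * (n * s)) (rowSum-∑ (suc k) l) ⟨
    n * (n * rowSum (suc k) l)
      ≤⟨ *-monoʳ-≤ n (*-monoʳ-≤ n few) ⟩
    n * (n * n) ∎
    where
    open ≤-Reasoning
    common : ℕ → ℕ → ℕ
    common i j = bit (a i j) * bit (a (suc k) j)

    pairs-≤ : ∀ i → ∑ l (λ m → bit (a (suc i) m) * ∑ (pred m) (common (suc i))) ≤ n * ∑ l (common (suc i))
    -- Row `suc i` may hold `n + 1` ones, but `m` differs from `j`. Adding the diagonal to both
    -- sides accounts for this and leaves the factor `n`.
    pairs-≤ i = +-cancelʳ-≤ (∑ l (common (suc i))) _ _ (begin
      ∑ l (λ m → bit (a (suc i) m) * ∑ (pred m) (common (suc i))) + ∑ l (common (suc i))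
        ≤⟨ ∑-strict-pairs l (bit ∘ a (suc i)) (common (suc i)) (λ j → bit*-absorb (a (suc i) j) _) ⟩
      ∑ l (bit ∘ a (suc i)) * ∑ l (common (suc i))
        ≤⟨ *-monoˡ-≤ _ (subst (_≤ suc n) (rowSum-∑ (suc i) l) (rowSum-≤ i l)) ⟩
      suc n * ∑ l (common (suc i))
        ≡⟨ +-comm (∑ l (common (suc i))) _ ⟩
      n * ∑ l (common (suc i)) + ∑ l (common (suc i)) ∎)

    column-≤ : ∀ j → ∑ k (λ i → common i (suc j)) ≤ n * bit (a (suc k) (suc j))
    column-≤ j = begin
      ∑ k (λ i → bit (a i (suc j)) * c)  ≡⟨ ∑-cong k (λ i → *-comm (bit (a i (suc j))) c) ⟩
      ∑ k (λ i → c * bit (a i (suc j)))  ≡⟨ *-∑ k c (λ i → bit (a i (suc j))) ⟩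
      c * ∑ k (λ i → bit (a i (suc j)))  ≡⟨ cong (c *_) (colSum-∑ k (suc j)) ⟨
      c * colSum k (suc j)               ≤⟨ c*colSum-≤ ⟩
      c * n                              ≡⟨ *-comm c n ⟩
      n * c                              ∎
      where
      c = bit (a (suc k) (suc j))
      c*colSum-≤ : c * colSum k (suc j) ≤ c * n
      -- A 1 at `(suc k , suc j)` certifies at most `n` ones above it; at a 0 the factor `c`
      -- vanishes.
      c*colSum-≤ with a (suc k) (suc j) in e
      ... | false = z≤n
      ... | true  = *-monoʳ-≤ 1 (colSum-before k j e)

  band-right : ∀ k l → a k l ≡ true → l ≤ k + width
  band-right (suc k) (suc l) e = s≤s (begin
    l                                          ≡⟨ *-identityʳ l ⟨
    l * 1                                      ≡⟨ ∑-const l 1 ⟨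
    ∑ l (λ _ → 1)                              ≤⟨ ∑-mono l cover ⟩
    ∑ l (λ m → ones m + full m + corners m)    ≡⟨ ∑-+ l (λ m → ones m + full m) corners ⟩
    ∑ l (λ m → ones m + full m) + ∑ l corners  ≡⟨ cong (_+ ∑ l corners) (∑-+ l ones full) ⟩
    ∑ l ones + ∑ l full + ∑ l corners          ≤⟨ +-mono-≤ (+-mono-≤ (subst (_≤ n) (rowSum-∑ (suc k) l) few) (full-columns-≤ k l)) (corners-≤ k l few) ⟩
    n + k + n * (n * n)                        ≡⟨ regroup n k (n * (n * n)) ⟩
    k + width                                  ∎)
    where
    open ≤-Reasoning
    few : rowSum (suc k) l ≤ n
    few = rowSum-before k l e
    ones full corners : ℕ → ℕ
    ones m = bit (a (suc k) m)
    full m = bit (not (colSum k m <ᵇ n + 1))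
    corners m = ∑ k (λ i → bit (a i m) * ∑ (pred m) (λ j → bit (a i j) * bit (a (suc k) j)))
    -- The row condition holds at each earlier place, because row counts grow and the count just
    -- before the final 1 is still at most `n`.
    cover : ∀ m → m < l → 1 ≤ ones (suc m) + full (suc m) + corners (suc m)
    cover m m<l = ≤-trans
      (bit-cases (rowSum (suc k) m <ᵇ n + 1) (colSum k (suc m) <ᵇ n + 1) (corner (suc k) (suc m) k m)
        (<⇒<ᵇ (≤-trans (s≤s (≤-trans (rowSum-mono (suc k) (<⇒≤ m<l)) few)) (≤-reflexive (+-comm 1 n)))))
      (+-monoʳ-≤ (ones (suc m) + full (suc m)) (corner-≤ (suc k) (suc m) k m))
    regroup : ∀ n k c → n + k + c ≡ k + (c + n)
    regroup = ℕ-Solver.solve-∀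

  -- Symmetry and the two-sided band.

  rowSum-transpose : ∀ l m → (∀ j → j ≤ m → a l j ≡ a j l) → rowSum l m ≡ colSum m l
  rowSum-transpose l zero    eq = refl
  rowSum-transpose l (suc m) eq =
    cong₂ _+_ (rowSum-transpose l m (λ j j≤m → eq j (m≤n⇒m≤1+n j≤m))) (cong bit (eq (suc m) ≤-refl))

  -- Transposition exchanges the row and column conditions and turns a corner `(i , j)` into
  -- `(j , i)`. All entries that the rule reads have a smaller index sum, so the hypothesis covers
  -- them; for its use here `rowSum-transpose` assumes symmetry only along one line.
  transpose-entry : ∀ k l → (∀ i j → i + j < k + l → a i j ≡ a j i) → a k l ≡ true → a l k ≡ true
  transpose-entry (suc k) (suc l) ih e =
    let row , col , free = a-greedy (suc k) (suc l) (s≤s z≤n) (s≤s z≤n) .to e in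
    a-greedy (suc l) (suc k) (s≤s z≤n) (s≤s z≤n) .from
      ( subst (_< n + 1) (sym (rowSum-transpose (suc l) k (λ j j≤k → sym (ih j (suc l) (+-monoˡ-< (suc l) (s≤s j≤k)))))) col
      , subst (_< n + 1) (rowSum-transpose (suc k) l (λ j j≤l → ih (suc k) j (+-monoʳ-< (suc k) (s≤s j≤l)))) row
      , λ { (i , j , (1≤i , i<l) , (1≤j , j<k) , x , y , z) → free
            ( j , i , (1≤j , j<k) , (1≤i , i<l)
            , trans (ih j i (+-mono-< j<k i<l)) x
            , trans (ih j (suc l) (+-monoˡ-< (suc l) j<k)) z
            , trans (ih (suc k) i (+-monoʳ-< (suc k) i<l)) y ) } )

  a-symmetric : ∀ k l → a k l ≡ a l k
  a-symmetric k l = go (suc (k + l)) k l ≤-refl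
    where
    go : ∀ s k l → k + l < s → a k l ≡ a l k
    go (suc s) k l (s≤s k+l≤s) = ⇔→≡ {z = true} (mk⇔
      (transpose-entry k l (λ i j lt → go s i j (<-≤-trans lt k+l≤s)))
      (transpose-entry l k (λ i j lt → go s i j (<-≤-trans lt (subst (_≤ s) (+-comm k l) k+l≤s)))))

  band-left : ∀ k l → a k l ≡ true → k ≤ l + width
  band-left k l e = band-right l k (trans (a-symmetric l k) e)

  above-band : ∀ k l → k + width < l → a k l ≡ false
  above-band k l lt with a k l in e
  ... | false = refl
  ... | true  = contradiction (band-right k l e) (<⇒≱ lt)

  below-band : ∀ k l → l + width < k → a k l ≡ false
  below-band k l lt = trans (a-symmetric k l) (above-band l k lt)

  rowSum-below-band : ∀ k m → m + width < k → rowSum k m ≡ 0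
  rowSum-below-band k zero    lt = refl
  rowSum-below-band k (suc m) lt =
    cong₂ _+_ (rowSum-below-band k m (<⇒≤ lt)) (cong bit (below-band k (suc m) lt))

  -- Agreement of the quadrants beyond (q , q) and (q′ , q′)

  Agree : (q q′ x y : ℕ) → Set
  Agree q q′ x y = a (x + q) (y + q) ≡ a (x + q′) (y + q′)

  past-width : ∀ {x} q → width < x → q + width < x + q
  past-width {x} q w<x = subst (_< x + q) (+-comm width q) (+-monoˡ-< q w<x)

  -- For `x` beyond `width`, row `x + q` lies below the band in columns up to `q`, so its count
  -- effectively starts at the edge of the quadrant.
  rowSum-agree : ∀ q q′ x m → width < x → (∀ j → 1 ≤ j → j ≤ m → Agree q q′ x j) →
    rowSum (x + q) (m + q) ≡ rowSum (x + q′) (m + q′)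
  rowSum-agree q q′ x zero    w<x eq =
    trans (rowSum-below-band (x + q) q (past-width q w<x)) (sym (rowSum-below-band (x + q′) q′ (past-width q′ w<x)))
  rowSum-agree q q′ x (suc m) w<x eq = cong₂ _+_
    (rowSum-agree q q′ x m w<x (λ j 1≤j j≤m → eq j 1≤j (m≤n⇒m≤1+n j≤m)))
    (cong bit (eq (suc m) (s≤s z≤n) ≤-refl))

  agree-transpose : ∀ {q q′} x y → Agree q q′ x y → Agree q q′ y x
  agree-transpose {q} {q′} x y eq =
    trans (a-symmetric (y + q) (x + q)) (trans eq (a-symmetric (x + q′) (y + q′)))

  colSum-agree : ∀ q q′ y m → width < y → (∀ i → 1 ≤ i → i ≤ m → Agree q q′ i y) →
    colSum (m + q) (y + q) ≡ colSum (m + q′) (y + q′)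
  colSum-agree q q′ y m w<y eq =
    trans (sym (rowSum-transpose (y + q) (m + q) (λ j _ → a-symmetric (y + q) j)))
    (trans (rowSum-agree q q′ y m w<y (λ i 1≤i i≤m → agree-transpose i y (eq i 1≤i i≤m)))
           (rowSum-transpose (y + q′) (m + q′) (λ j _ → a-symmetric (y + q′) j)))

  >-offset : ∀ {q i} → q < i → ∃ λ x → 1 ≤ x × i ≡ x + q
  >-offset {q} {i} q<i = i ∸ q , m<n⇒0<n∸m q<i , sym (m∸n+n≡m (<⇒≤ q<i))

  -- The inequality `le` is what the band gives for a 1 in row `i` and column `y + q`, or in the
  -- transposed position. Hence the lemma serves both rows and columns.
  offset-in-quadrant : ∀ {q y i} → width < y → y + q ≤ i + width → ∃ λ x → 1 ≤ x × i ≡ x + q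
  offset-in-quadrant {q} {y} {i} w<y le =
    >-offset (+-cancelʳ-< width q i (<-≤-trans (past-width q w<y) le))

  -- Away from the first `width` rows and columns of the quadrant, the greedy rule depends only on
  -- earlier entries of the quadrant, and these agree by `ih`.
  agree-step : ∀ q q′ x y → width < x → width < y →
    (∀ x′ y′ → 1 ≤ x′ → 1 ≤ y′ → x′ + y′ < x + y → Agree q q′ x′ y′) →
    a (x + q) (y + q) ≡ true → a (x + q′) (y + q′) ≡ true
  agree-step q q′ (suc x) (suc y) w<x w<y ih e =
    let row , col , free = a-greedy (suc x + q) (suc y + q) (s≤s z≤n) (s≤s z≤n) .to e in
    a-greedy (suc x + q′) (suc y + q′) (s≤s z≤n) (s≤s z≤n) .from
      ( subst (_< n + 1) (rowSum-agree q q′ (suc x) y w<x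
          (λ j 1≤j j≤y → ih (suc x) j (s≤s z≤n) 1≤j (+-monoʳ-< (suc x) (s≤s j≤y)))) row
      , subst (_< n + 1) (colSum-agree q q′ (suc y) x w<y
          (λ i 1≤i i≤x → ih i (suc y) 1≤i (s≤s z≤n) (+-monoˡ-< (suc y) (s≤s i≤x)))) col
      , λ { (i , j , (_ , i<) , (_ , j<) , u , v , w) → free (pull-back i j i< j< u v w) } )
    where
    pull-back : ∀ i j → i < suc x + q′ → j < suc y + q′ →
      a i j ≡ true → a i (suc y + q′) ≡ true → a (suc x + q′) j ≡ true →
      ∃₂ λ i j → (1 ≤ i × i < suc x + q) × (1 ≤ j × j < suc y + q)
        × a i j ≡ true × a i (suc y + q) ≡ true × a (suc x + q) j ≡ true
    pull-back i j i< j< u v w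
      -- The rectangle has ones in column `suc y + q′` and row `suc x + q′`. The band therefore
      -- forces `i` and `j` beyond `q′`, and the rectangle can be moved to `q`.
      with offset-in-quadrant {q′} {suc y} {i} w<y (band-right i (suc y + q′) v)
         | offset-in-quadrant {q′} {suc x} {j} w<x (band-left (suc x + q′) j w)
    ... | i′ , 1≤i′ , refl | j′ , 1≤j′ , refl =
      let i′<x = +-cancelʳ-< q′ i′ (suc x) i<
          j′<y = +-cancelʳ-< q′ j′ (suc y) j<
      in i′ + q , j′ + q
       , (≤-trans 1≤i′ (m≤m+n i′ q) , +-monoˡ-< q i′<x)
       , (≤-trans 1≤j′ (m≤m+n j′ q) , +-monoˡ-< q j′<y)
       , trans (ih i′ j′ 1≤i′ 1≤j′ (+-mono-< i′<x j′<y)) u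
       , trans (ih i′ (suc y) 1≤i′ (s≤s z≤n) (+-monoˡ-< (suc y) i′<x)) v
       , trans (ih (suc x) j′ (s≤s z≤n) 1≤j′ (+-monoʳ-< (suc x) j′<y)) w

  module _ (q q′ : ℕ)
    (window : ∀ x y → 1 ≤ x → x ≤ width → 1 ≤ y → y ≤ 2 * width → Agree q q′ x y) where

    -- Two widths of columns suffice: in the first `width` rows of the quadrant, everything further
    -- right is above the band and hence 0 on both sides.
    agree-top : ∀ x y → 1 ≤ x → x ≤ width → 1 ≤ y → Agree q q′ x y
    agree-top x y 1≤x x≤w 1≤y with y ≤? 2 * width
    ... | yes y≤2w = window x y 1≤x x≤w 1≤y y≤2w
    ... | no  y≰2w = trans (above-band (x + q) (y + q) (far q)) (sym (above-band (x + q′) (y + q′) (far q′)))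
      where
      open ≤-Reasoning
      far : ∀ r → x + r + width < y + r
      far r = begin-strict
        x + r + width      ≡⟨ regroup x r width ⟩
        x + width + r      ≤⟨ +-monoˡ-≤ r (+-monoˡ-≤ width x≤w) ⟩
        width + width + r  ≡⟨ cong (λ v → width + v + r) (+-identityʳ width) ⟨
        2 * width + r      <⟨ +-monoˡ-< r (≰⇒> y≰2w) ⟩
        y + r              ∎
        where
        regroup : ∀ x r w → x + r + w ≡ x + w + r
        regroup = ℕ-Solver.solve-∀

    -- Strong induction on `x + y`, with `s` as its bound. The top strip is `agree-top`, the left
    -- strip its transpose, and the interior uses `agree-step` in both directions, with `q` and `q′`
    -- exchanged in the second.
    agree-quadrant : ∀ x y → 1 ≤ x → 1 ≤ y → Agree q q′ x y
    agree-quadrant x y 1≤x 1≤y = go (suc (x + y)) x y ≤-refl 1≤x 1≤y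
      where
      go : ∀ s x y → x + y < s → 1 ≤ x → 1 ≤ y → Agree q q′ x y
      go (suc s) x y (s≤s x+y≤s) 1≤x 1≤y with x ≤? width | y ≤? width
      ... | yes x≤w | _       = agree-top x y 1≤x x≤w 1≤y
      ... | no  _   | yes y≤w = agree-transpose y x (agree-top y x 1≤y y≤w 1≤x)
      ... | no  x≰w | no  y≰w = ⇔→≡ {z = true} (mk⇔
        (agree-step q q′ x y (≰⇒> x≰w) (≰⇒> y≰w) ih)
        (agree-step q′ q x y (≰⇒> x≰w) (≰⇒> y≰w)
          (λ x′ y′ 1≤x′ 1≤y′ lt → sym (ih x′ y′ 1≤x′ 1≤y′ lt))))
        where
        ih : ∀ x′ y′ → 1 ≤ x′ → 1 ≤ y′ → x′ + y′ < x + y → Agree q q′ x′ y′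
        ih x′ y′ 1≤x′ 1≤y′ lt = go s x′ y′ (<-≤-trans lt x+y≤s) 1≤x′ 1≤y′

  -- Coding the window at q by a number below 2 ^ (w · 2w)

  code-bit : Bool → Fin 2
  code-bit false = 0F
  code-bit true  = sucF 0F

  code-bit-injective : ∀ {b c} → code-bit b ≡ code-bit c → b ≡ c
  code-bit-injective {false} {false} _ = refl
  code-bit-injective {true}  {true}  _ = refl

  windowBits : ℕ
  windowBits = width * (2 * width)

  window-entry : ℕ → Fin width × Fin (2 * width) → Fin 2
  window-entry q (x , y) = code-bit (a (suc (toℕ x) + q) (suc (toℕ y) + q))

  window-code : ℕ → Fin (2 ^ windowBits)
  window-code q = funToFin (window-entry q ∘ remQuot {width} (2 * width))

  window-code-injective : ∀ q q′ → window-code q ≡ window-code q′ →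
    ∀ x y → 1 ≤ x → x ≤ width → 1 ≤ y → y ≤ 2 * width → Agree q q′ x y
  window-code-injective q q′ eq (suc x) (suc y) _ x<w _ y<2w =
    -- Window positions start at 1 and `Fin` at 0, so `suc x ≤ width` is read as `x < width`.
    subst₂ (λ x y → Agree q q′ (suc x) (suc y)) (toℕ-fromℕ< x<w) (toℕ-fromℕ< y<2w)
      (code-bit-injective (trans (sym (decode q)) (trans (cong (λ c → finToFun c (combine X Y)) eq) (decode q′))))
    where
    X = fromℕ< x<w
    Y = fromℕ< y<2w
    decode : ∀ r → finToFun (window-code r) (combine X Y) ≡ window-entry r (X , Y)
    decode r = trans (finToFun-funToFin (window-entry r ∘ remQuot {width} (2 * width)) (combine X Y))
                     (cong (window-entry r) (remQuot-combine X Y))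

  -- Periodicity by the pigeonhole principle.

  eventually-periodic : ∃₂ λ pp p → p ≥ 1
    × (∀ i j → i > pp → j ≥ 1 → a (i + p) (j + p) ≡ a i j)
    × pp + p ≤ 2 ^ windowBits + width
  eventually-periodic
    with pigeonhole ≤-refl (λ (q : Fin (suc (2 ^ windowBits))) → window-code (toℕ q))
  -- The quadrant argument is silent about columns up to `q`. Adding `width` to the preperiod puts
  -- these below the band, where both entries are 0.
  ... | f , f′ , f<f′ , eq = q + width , p , m<n⇒0<n∸m f<f′ , periodic , bound
    where
    q q′ p : ℕ
    q = toℕ f
    q′ = toℕ f′
    p = q′ ∸ q
    q+p≡q′ : q + p ≡ q′
    q+p≡q′ = m+[n∸m]≡n (<⇒≤ f<f′)
    shift : ∀ x → x + q + p ≡ x + q′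
    shift x = trans (+-assoc x q p) (cong (λ s → x + s) q+p≡q′)

    periodic : ∀ i j → i > q + width → j ≥ 1 → a (i + p) (j + p) ≡ a i j
    periodic i j i> 1≤j with j ≤? q
    ... | yes j≤q = trans (below-band (i + p) (j + p) far′) (sym (below-band i j far))
      where
      far : j + width < i
      far = ≤-<-trans (+-monoˡ-≤ width j≤q) i>
      far′ : j + p + width < i + p
      far′ = subst (_< i + p)
        (trans (+-assoc j width p) (trans (cong (λ s → j + s) (+-comm width p)) (sym (+-assoc j p width))))
        (+-monoˡ-< p far)
    ... | no j≰q with >-offset (≤-<-trans (m≤m+n q width) i>) | >-offset (≰⇒> j≰q)
    ... | x , 1≤x , refl | y , 1≤y , refl =
      trans (cong₂ a (shift x) (shift y))
        (sym (agree-quadrant q q′ (window-code-injective q q′ eq) x y 1≤x 1≤y))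

    bound : q + width + p ≤ 2 ^ windowBits + width
    bound = begin
      q + width + p          ≡⟨ +-assoc q width p ⟩
      q + (width + p)        ≡⟨ cong (λ s → q + s) (+-comm width p) ⟩
      q + (p + width)        ≡⟨ +-assoc q p width ⟨
      q + p + width          ≡⟨ cong (_+ width) q+p≡q′ ⟩
      q′ + width             ≤⟨ +-monoˡ-≤ width (≤-pred (toℕ<n f′)) ⟩
      2 ^ windowBits + width ∎
      where open ≤-Reasoning

-- Comparison of the bound with `σ`.

n<2^n : ∀ n → n < 2 ^ n
n<2^n zero    = s≤s z≤n
n<2^n (suc n) = begin-strict
  suc n             <⟨ +-mono-≤-< (m^n>0 2 n) (n<2^n n) ⟩
  2 ^ n + 2 ^ n     ≡⟨ cong (λ s → 2 ^ n + s) (+-identityʳ (2 ^ n)) ⟨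
  2 ^ suc n         ∎
  where open ≤-Reasoning

σ-suc : ∀ m → ∣ σ (suc m) ∣ ≡ 2 * (m * (m * m)) + 5 * (m * m) + 7 * m + 4
σ-suc m = cong ∣_∣ (trans (expand (+ m)) (sym lift))
  where
  expand : ∀ x → + 2 ℤ.* ((+ 1 ℤ.+ x) ℤ.* ((+ 1 ℤ.+ x) ℤ.* ((+ 1 ℤ.+ x) ℤ.* + 1))) ℤ.- (+ 1 ℤ.+ x) ℤ.* ((+ 1 ℤ.+ x) ℤ.- + 3)
    ≡ + 2 ℤ.* (x ℤ.* (x ℤ.* x)) ℤ.+ + 5 ℤ.* (x ℤ.* x) ℤ.+ + 7 ℤ.* x ℤ.+ + 4
  expand = ℤ-Solver.solve-∀
  -- The cast commutes with sums by computation; only the products need rewriting.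
  lift : + (2 * (m * (m * m)) + 5 * (m * m) + 7 * m + 4)
    ≡ + 2 ℤ.* (+ m ℤ.* (+ m ℤ.* + m)) ℤ.+ + 5 ℤ.* (+ m ℤ.* + m) ℤ.+ + 7 ℤ.* + m ℤ.+ + 4
  lift = cong (ℤ._+ + 4) (cong₂ ℤ._+_ (cong₂ ℤ._+_
    (trans (ℤ.pos-* 2 (m * (m * m))) (cong (+ 2 ℤ.*_) (trans (ℤ.pos-* m (m * m)) (cong (+ m ℤ.*_) (ℤ.pos-* m m)))))
    (trans (ℤ.pos-* 5 (m * m)) (cong (+ 5 ℤ.*_) (ℤ.pos-* m m))))
    (ℤ.pos-* 7 m))

-- After `n = suc m` the gap is a polynomial in `m` with nonnegative coefficients, given explicitly
-- as `slack`. Strictness pays for one doubling of the power of 2.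
windowBits<σ² : ∀ n → n ≥ 1 → windowBits n < ∣ σ n ℤ.^ 2 ∣
windowBits<σ² (suc m) _ = begin
  suc (windowBits (suc m))             ≤⟨ m≤m+n _ _ ⟩
  suc (windowBits (suc m)) + slack m   ≡⟨ expand m ⟩
  s * s                                ≡⟨ cong₂ _*_ (σ-suc m) (σ-suc m) ⟨
  ∣ σ (suc m) ∣ * ∣ σ (suc m) ∣         ≡⟨ ℤ.abs-* (σ (suc m)) (σ (suc m)) ⟨
  ∣ σ (suc m) ℤ.* σ (suc m) ∣           ≡⟨ cong (λ t → ∣ σ (suc m) ℤ.* t ∣) (ℤ.*-identityʳ (σ (suc m))) ⟨
  ∣ σ (suc m) ℤ.^ 2 ∣                   ∎
  where
  open ≤-Reasoning
  s = 2 * (m * (m * m)) + 5 * (m * m) + 7 * m + 4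
  slack : ℕ → ℕ
  slack m = 2 * (m * m * m * m * m * m) + 8 * (m * m * m * m * m) + 19 * (m * m * m * m)
    + 30 * (m * m * m) + 33 * (m * m) + 24 * m + 7
  expand : ∀ m →
    1 + ((1 + m) * ((1 + m) * (1 + m)) + (1 + m)) * (2 * ((1 + m) * ((1 + m) * (1 + m)) + (1 + m)))
      + (2 * (m * m * m * m * m * m) + 8 * (m * m * m * m * m) + 19 * (m * m * m * m)
         + 30 * (m * m * m) + 33 * (m * m) + 24 * m + 7)
    ≡ (2 * (m * (m * m)) + 5 * (m * m) + 7 * m + 4) * (2 * (m * (m * m)) + 5 * (m * m) + 7 * m + 4)
  expand = ℕ-Solver.solve-∀

width≤windowBits : ∀ n → width n ≤ windowBits n
width≤windowBits n with width n
... | zero  = z≤n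
... | suc w = m≤m*n (suc w) (2 * suc w)

theorem3p3 : (n : ℕ) → n ≥ 1 →
    ∃₂ λ (pp p : ℕ) →
    p ≥ 1
    × (∀ (i j : ℕ) → i > pp → j ≥ 1 → A n (i + p) (j + p) ≡ A n i j)
    × pp + p ≤ 2 ^ ∣ (σ n) ℤ.^ 2 ∣
theorem3p3 n n≥1 with eventually-periodic n
... | pp , p , p≥1 , periodic , bound = pp , p , p≥1 , periodic , (begin
  pp + p                                ≤⟨ bound ⟩
  -- The summand `width n` is absorbed into a second copy of the power, and the strict exponent
  -- bound then absorbs the factor 2.
  2 ^ windowBits n + width n            ≤⟨ +-monoʳ-≤ (2 ^ windowBits n) (≤-trans (width≤windowBits n) (<⇒≤ (n<2^n (windowBits n)))) ⟩
  2 ^ windowBits n + 2 ^ windowBits n   ≡⟨ cong (λ s → 2 ^ windowBits n + s) (+-identityʳ (2 ^ windowBits n)) ⟨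
  2 ^ suc (windowBits n)                ≤⟨ ^-monoʳ-≤ 2 (windowBits<σ² n n≥1) ⟩
  2 ^ ∣ (σ n) ℤ.^ 2 ∣                   ∎)
  where open ≤-Reasoning
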